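{- Let $n\geq 3$ be an integer. If the generalized quaternion group $\mathrm{Q}_{4n}$ of order $4n$ is a DCI-group, then $n$ is odd and square-free.
   Context: The generalized quaternion (dicyclic) group of order $4n$ is $\mathrm{Q}_{4n}=\langle a,b\mid a^{2n}=1,\ b^2=a^n,\ b^{ -1}ab=a^{ -1}\rangle$. For a finite group $G$ and a subset $S\subseteq G$ with $1\notin S$, the Cayley digraph $\mathrm{Cay}(G,S)$ is the digraph with vertex set $G$ and arc set $\{(g,sg)\mid g\in G,\ s\in S\}$. $\mathrm{Cay}(G,S)$ is called a CI-digraph if for every subset $T\subseteq G$ with $1\notin T$ such that $\mathrm{Cay}(G,T)\cong\mathrm{Cay}(G,S)$ as digraphs, there exists $\sigma\in\mathrm{Aut}(G)$ with $S^\sigma=T$. $G$ is a DCI-group if all Cayley digraphs of $G$ are CI-digraphs. -}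

module Defs where

open import Algebra.Bundles using (Group)
open import Algebra.Morphism.Structures using (module GroupMorphisms)
open import Data.Nat using (ℕ; zero; suc; _*_)
open import Data.Nat.Divisibility using (_∣_)
open import Data.Product using (Σ-syntax; ∃-syntax; _×_; _,_)
open import Function.Bundles using (_⇔_)
open import Level using (0ℓ)
open import Relation.Binary.Bundles using (Setoid)
open import Relation.Binary.Core using (Rel)
open import Relation.Binary.Definitions using (_Respects_; _Respects₂_)
open import Relation.Binary.Morphism.Structures using (IsOrderIsomorphism)
open import Relation.Binary.PropositionalEquality using (_≡_)
open import Relation.Nullary using (¬_)
open import Relation.Unary using (Pred; Decidable)

Odd : ℕ → Set
Odd n = ¬ (2 ∣ n)

SquareFree : ℕ → Set
SquareFree n = ∀ d → d * d ∣ n → d ≡ 1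

infixl 7 _·_
infix  8 _⁻¹ʷ
infix  9 _^ʷ_

data Word (X : Set) : Set where
  gen  : X → Word X
  1ʷ   : Word X
  _·_  : Word X → Word X → Word X
  _⁻¹ʷ : Word X → Word X

_^ʷ_ : {X : Set} → Word X → ℕ → Word X
w ^ʷ zero  = 1ʷ
w ^ʷ suc k = w · w ^ʷ k

-- The least group congruence on words containing R, so that
-- ⟨ X ∣ R ⟩ below is the group presented by generators X and relations R.
data Presented {X : Set} (R : Rel (Word X) 0ℓ) : Rel (Word X) 0ℓ where
  rel       : ∀ {u v} → R u v → Presented R u v
  ≈-refl    : ∀ {u} → Presented R u u
  ≈-sym     : ∀ {u v} → Presented R u v → Presented R v u
  ≈-trans   : ∀ {u v w} → Presented R u v → Presented R v w → Presented R u w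
  ·-cong    : ∀ {u u′ v v′} → Presented R u u′ → Presented R v v′ →
              Presented R (u · v) (u′ · v′)
  ⁻¹-cong   : ∀ {u v} → Presented R u v → Presented R (u ⁻¹ʷ) (v ⁻¹ʷ)
  ·-assoc   : ∀ u v w → Presented R ((u · v) · w) (u · (v · w))
  identityˡ : ∀ u → Presented R (1ʷ · u) u
  identityʳ : ∀ u → Presented R (u · 1ʷ) u
  inverseˡ  : ∀ u → Presented R (u ⁻¹ʷ · u) 1ʷ
  inverseʳ  : ∀ u → Presented R (u · u ⁻¹ʷ) 1ʷ

⟨_∣_⟩ : (X : Set) → Rel (Word X) 0ℓ → Group 0ℓ 0ℓ
⟨ X ∣ R ⟩ = record
  { Carrier = Word X
  ; _≈_     = Presented R
  ; _∙_     = _·_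
  ; ε       = 1ʷ
  ; _⁻¹     = _⁻¹ʷ
  ; isGroup = record
    { isMonoid = record
      { isSemigroup = record
        { isMagma = record
          { isEquivalence = record
            { refl = ≈-refl ; sym = ≈-sym ; trans = ≈-trans }
          ; ∙-cong = ·-cong
          }
        ; assoc = ·-assoc
        }
      ; identity = identityˡ , identityʳ
      }
    ; inverse = inverseˡ , inverseʳ
    ; ⁻¹-cong = ⁻¹-cong
    }
  }

data QGen : Set where
  a b : QGen

data QRel (n : ℕ) : Rel (Word QGen) 0ℓ where
  a²ⁿ≈1     : QRel n (gen a ^ʷ (2 * n)) 1ʷ
  b²≈aⁿ     : QRel n (gen b ^ʷ 2) (gen a ^ʷ n)
  b⁻¹ab≈a⁻¹ : QRel n (gen b ⁻¹ʷ · gen a · gen b) (gen a ⁻¹ʷ)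

-- Q₄ n is the generalized quaternion group of order 4n.
Q₄ : ℕ → Group 0ℓ 0ℓ
Q₄ n = ⟨ QGen ∣ QRel n ⟩

record Digraph : Set₁ where
  field
    vertices : Setoid 0ℓ 0ℓ
  open Setoid vertices public using (_≈_) renaming (Carrier to Vertex)
  field
    Arc      : Rel Vertex 0ℓ
    Arc-resp : Arc Respects₂ _≈_

-- IsOrderIsomorphism assumes nothing of the two relations: it says that f is a
-- bijection of vertices which both preserves and reflects arcs.
_≅_ : Digraph → Digraph → Set
Γ ≅ Δ = Σ[ f ∈ (Γ.Vertex → Δ.Vertex) ]
          IsOrderIsomorphism Γ._≈_ Δ._≈_ Γ.Arc Δ.Arc f
  where
  module Γ = Digraph Γ
  module Δ = Digraph Δ

module _ (G : Group 0ℓ 0ℓ) where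
  open Group G
  open GroupMorphisms rawGroup rawGroup using (IsGroupIsomorphism)

  -- A subset of G not containing the identity. Subsets of a finite set are
  -- rendered as decidable predicates (which must respect the equality of G).
  record ConnectionSet : Set₁ where
    field
      Mem      : Pred Carrier 0ℓ
      Mem?     : Decidable Mem
      Mem-resp : Mem Respects _≈_
      ε∉       : ¬ Mem ε

  open ConnectionSet

  Cay : ConnectionSet → Digraph
  Cay S = record
    { vertices = setoid
    ; Arc      = λ g h → ∃[ s ] (Mem S s × h ≈ s ∙ g)
    ; Arc-resp = (λ { h≈h′ (s , s∈S , e) → s , s∈S , trans (sym h≈h′) e })
               , (λ { g≈g′ (s , s∈S , e) → s , s∈S , trans e (∙-congˡ g≈g′) })
    }

  IsCI : ConnectionSet → Set₁
  IsCI S = (T : ConnectionSet) → Cay T ≅ Cay S →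
           Σ[ σ ∈ (Carrier → Carrier) ]
             (IsGroupIsomorphism σ ×
              (∀ t → Mem T t ⇔ (∃[ s ] (Mem S s × t ≈ σ s))))

  -- Intended for finite G only.
  IsDCI : Set₁
  IsDCI = (S : ConnectionSet) → IsCI S

{-# OPTIONS --safe #-}
module Submission where

-- Every element of Q₄ n is aⁱbᵉ with i modulo 2n and e a bit, and two subsets of
-- Q₄ n with isomorphic Cayley digraphs are exhibited which no automorphism relates.
-- If n is even, these are the complements of the index-two subgroups ⟨a⟩, which is
-- abelian, and ⟨a², b⟩, which is not as n ≥ 3; the digraphs are both complete bipartite.
-- If d² divides n for some d ≥ 3, put M = 2n/d and take the coset a⟨aᴹ⟩ together with
-- aᴹ, respectively with a⁻ᴹ; both digraphs are lexicographic products with directed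
-- d-cycles. An automorphism between them sends a to a¹⁺ᵏᴹ, hence fixes aᴹ since
-- 2n ∣ M², or else it sends a to a⁻ᴹ, an element of too small order.

open import Defs
open import Algebra.Bundles using (Group)
open import Algebra.Morphism.Structures using (module GroupMorphisms)
open import Data.Bool.Base using (Bool; true; false)
open import Data.Bool.Properties using (_≟_)
open import Data.Integer.Base using (ℤ; +_; -_; _-_; 0ℤ; 1ℤ; -1ℤ; ∣_∣) renaming (_+_ to _+ᶻ_; _*_ to _*ᶻ_)
open import Data.Integer.DivMod using (_%ℕ_; _/ℕ_; n%ℕd<d; a≡a%ℕn+[a/ℕn]*n)
open import Data.Integer.Divisibility.Signed using (divides; ∣⇒∣ᵤ; ∣ᵤ⇒∣; _∣?_; ∣m∣n⇒∣m+n; ∣m⇒∣-m; ∣n⇒∣m*n) renaming (_∣_ to _∣ᶻ_; ∣-trans to ∣ᶻ-trans)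
import Data.Integer.Properties as ℤₚ
open import Data.Integer.Tactic.RingSolver using (solve-∀)
open import Data.Nat.Base using (zero; suc; _+_; _*_; _∸_; _<_; _≡ᵇ_; s<s; s≤s; z≤n; NonZero; >-nonZero; ≢-nonZero⁻¹)
open import Data.Nat using (ℕ; _≤_)
import Data.Nat.Divisibility as ℕ∣
open import Data.Nat.Divisibility using (_∣_; ∣⇒≤; >⇒∤; m∣m*n; n∣m*n; *-cancelʳ-∣; ∣-trans; 0∣⇒≡0)
open import Data.Nat.DivMod using (_%_; _/_; m≡m%n+[m/n]*n)
import Data.Nat.Properties as ℕₚ
open import Data.Nat.Tactic.RingSolver using () renaming (solve-∀ to ℕ-solve-∀)
open import Data.Product using (_×_; _,_; proj₁; proj₂; ∃-syntax)
open import Data.Sum.Base as Sum using (_⊎_; inj₁; inj₂)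
open import Function.Base using (_∘_)
open import Function.Bundles using (_⇔_; module Equivalence)
open import Level using (0ℓ)
open import Relation.Binary.PropositionalEquality using (_≡_; _≢_; refl; sym; trans; cong; subst; module ≡-Reasoning)
import Relation.Binary.Reasoning.Setoid as SetoidReasoning
open import Relation.Nullary using (¬_; Dec; contradiction)
open import Relation.Nullary.Decidable using (map′; ¬?; _×-dec_; _⊎-dec_; decidable-stable)
open import Relation.Unary using (Decidable)

-- Congruence of integers modulo m, and uniqueness of remainders.

infix 4 _≋_[_]

-- A record, so that i and j can be inferred from a congruence.
record _≋_[_] (i j : ℤ) (m : ℕ) : Set where
  constructor by-∣
  field
    m∣i-j : + m ∣ᶻ i - j

open _≋_[_] using (m∣i-j)

module _ {m : ℕ} where

  ≋-reflexive : ∀ {i j} → i ≡ j → i ≋ j [ m ]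
  ≋-reflexive {i} refl = by-∣ (divides 0ℤ (ℤₚ.+-inverseʳ i))

  ≋-refl : ∀ {i} → i ≋ i [ m ]
  ≋-refl = ≋-reflexive refl

  ≋-sym : ∀ {i j} → i ≋ j [ m ] → j ≋ i [ m ]
  ≋-sym {i} {j} (by-∣ p) = by-∣ (subst (+ m ∣ᶻ_) (flip i j) (∣m⇒∣-m p))
    where
    flip : ∀ i j → - (i - j) ≡ j - i
    flip = solve-∀

  ≋-trans : ∀ {i j k} → i ≋ j [ m ] → j ≋ k [ m ] → i ≋ k [ m ]
  ≋-trans {i} {j} {k} (by-∣ p) (by-∣ q) = by-∣ (subst (+ m ∣ᶻ_) (telescope i j k) (∣m∣n⇒∣m+n p q))
    where
    telescope : ∀ i j k → (i - j) +ᶻ (j - k) ≡ i - k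
    telescope = solve-∀

  +-cong-≋ : ∀ {i i′ j j′} → i ≋ i′ [ m ] → j ≋ j′ [ m ] → i +ᶻ j ≋ i′ +ᶻ j′ [ m ]
  +-cong-≋ {i} {i′} {j} {j′} (by-∣ p) (by-∣ q) = by-∣ (subst (+ m ∣ᶻ_) (swap i i′ j j′) (∣m∣n⇒∣m+n p q))
    where
    swap : ∀ i i′ j j′ → (i - i′) +ᶻ (j - j′) ≡ (i +ᶻ j) - (i′ +ᶻ j′)
    swap = solve-∀

  neg-cong-≋ : ∀ {i j} → i ≋ j [ m ] → - i ≋ - j [ m ]
  neg-cong-≋ {i} {j} (by-∣ p) = by-∣ (subst (+ m ∣ᶻ_) (distrib i j) (∣m⇒∣-m p))
    where
    distrib : ∀ i j → - (i - j) ≡ - i - - j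
    distrib = solve-∀

  *-congˡ-≋ : ∀ c {i j} → i ≋ j [ m ] → c *ᶻ i ≋ c *ᶻ j [ m ]
  *-congˡ-≋ c {i} {j} (by-∣ p) = by-∣ (subst (+ m ∣ᶻ_) (distrib c i j) (∣n⇒∣m*n c p))
    where
    distrib : ∀ c i j → c *ᶻ (i - j) ≡ c *ᶻ i - c *ᶻ j
    distrib = solve-∀

≋-difference : ∀ {m i j} → i - j ≋ 0ℤ [ m ] → i ≋ j [ m ]
≋-difference {m} {i} {j} (by-∣ p) = by-∣ (subst (+ m ∣ᶻ_) (ℤₚ.+-identityʳ (i - j)) p)

≋-dec : ∀ m i j → Dec (i ≋ j [ m ])
≋-dec m i j = map′ by-∣ m∣i-j (+ m ∣? i - j)

≋-weaken : ∀ {l m i j} → l ∣ m → i ≋ j [ m ] → i ≋ j [ l ]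
≋-weaken l∣m (by-∣ p) = by-∣ (∣ᶻ-trans (∣ᵤ⇒∣ l∣m) p)

-≋⇒∣+ : ∀ {m x y} → + x ≋ - + y [ m ] → m ∣ x + y
-≋⇒∣+ {m} {x} {y} p = subst (λ z → m ∣ ∣ + x +ᶻ z ∣) (ℤₚ.neg-involutive (+ y)) (∣⇒∣ᵤ (m∣i-j p))

≋0⇒∣ : ∀ {m x} → + x ≋ 0ℤ [ m ] → m ∣ x
≋0⇒∣ {m} {x} p = subst (m ∣_) (ℕₚ.+-identityʳ x) (∣⇒∣ᵤ (m∣i-j p))

module _ (m : ℕ) .{{_ : NonZero m}} where

  ≋-remainder : ∀ i → i ≋ + (i %ℕ m) [ m ]
  ≋-remainder i = by-∣ (divides (i /ℕ m)
    (trans (cong (_- + (i %ℕ m)) (a≡a%ℕn+[a/ℕn]*n i m)) (cancel (+ (i %ℕ m)) _)))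
    where
    cancel : ∀ r s → (r +ᶻ s) - r ≡ s
    cancel = solve-∀

  private
    ≋⇒≥ : ∀ {r s} → r ≤ s → s < m → + r ≋ + s [ m ] → s ≤ r
    ≋⇒≥ {r} {s} r≤s s<m p = ℕₚ.m∸n≡0⇒m≤n (below (s ∸ r) (ℕₚ.≤-<-trans (ℕₚ.m∸n≤m s r) s<m) m∣s∸r)
      where
      m∣s∸r : m ∣ s ∸ r
      m∣s∸r = subst (m ∣_) (trans (cong ∣_∣ (ℤₚ.m-n≡m⊖n r s)) (ℤₚ.∣⊖∣-≤ r≤s)) (∣⇒∣ᵤ (m∣i-j p))
      below : ∀ k → k < m → m ∣ k → k ≡ 0
      below zero    _   _   = refl
      below (suc k) k<m m∣k = contradiction m∣k (>⇒∤ k<m)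

  ≋-small : ∀ {r s} → r < m → s < m → + r ≋ + s [ m ] → r ≡ s
  ≋-small {r} {s} r<m s<m p with ℕₚ.≤-total r s
  ... | inj₁ r≤s = ℕₚ.≤-antisym r≤s (≋⇒≥ r≤s s<m p)
  ... | inj₂ s≤r = ℕₚ.≤-antisym (≋⇒≥ s≤r r<m (≋-sym p)) s≤r

  %ℕ-cong : ∀ {i j} → i ≋ j [ m ] → i %ℕ m ≡ j %ℕ m
  %ℕ-cong {i} {j} p = ≋-small (n%ℕd<d i m) (n%ℕd<d j m)
    (≋-trans (≋-sym (≋-remainder i)) (≋-trans p (≋-remainder j)))

-- Isomorphisms of Cayley digraphs given by involutions.

module _ (G : Group 0ℓ 0ℓ) where
  open Group G renaming (refl to ≈ᴳ-refl; sym to ≈ᴳ-sym; trans to ≈ᴳ-trans; ⁻¹-cong to ⁻¹-congᴳ)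
  open import Algebra.Properties.Group G using (//-rightDividesˡ; //-rightDividesʳ)
  open ConnectionSet

  arc⇒∈ : ∀ S {g h} → Digraph.Arc (Cay G S) g h → Mem S (h ∙ g ⁻¹)
  arc⇒∈ S {g} (s , s∈S , h≈sg) =
    Mem-resp S (≈ᴳ-sym (≈ᴳ-trans (∙-congʳ h≈sg) (//-rightDividesʳ g s))) s∈S

  ∈⇒arc : ∀ S {g h} → Mem S (h ∙ g ⁻¹) → Digraph.Arc (Cay G S) g h
  ∈⇒arc S {g} {h} hg⁻¹∈S = h ∙ g ⁻¹ , hg⁻¹∈S , ≈ᴳ-sym (//-rightDividesˡ g h)

  -- As `f` is its own inverse, bijectivity follows from `f-inv` and `f-cong`. Arcs are reflected by
  -- applying `T⇒S` to the images and then undoing `f` on both ends.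
  involution⇒≅ : ∀ S T (f : Carrier → Carrier) →
    (∀ {g h} → g ≈ h → f g ≈ f h) → (∀ g → f (f g) ≈ g) →
    (∀ g h → Mem S (h ∙ g ⁻¹) → Mem T (f h ∙ f g ⁻¹)) →
    (∀ g h → Mem T (h ∙ g ⁻¹) → Mem S (f h ∙ f g ⁻¹)) →
    Cay G S ≅ Cay G T
  involution⇒≅ S T f f-cong f-inv S⇒T T⇒S = f , record
    { isOrderMonomorphism = record
      { isOrderHomomorphism = record
        { cong = f-cong
        ; mono = λ {g} {h} arc → ∈⇒arc T (S⇒T g h (arc⇒∈ S arc))
        }
      ; injective = λ {g} {h} fg≈fh →
          ≈ᴳ-trans (≈ᴳ-sym (f-inv g)) (≈ᴳ-trans (f-cong fg≈fh) (f-inv h))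
      ; cancel = λ {g} {h} arc → ∈⇒arc S
          (Mem-resp S (∙-cong (f-inv h) (⁻¹-congᴳ (f-inv g))) (T⇒S (f g) (f h) (arc⇒∈ T arc)))
      }
    ; surjective = λ g → f g , λ h≈fg → ≈ᴳ-trans (f-cong h≈fg) (f-inv g)
    }

-- The group of normal forms, as a model of the presentation.

-- The pair (i , e) stands for aⁱbᵉ.
NF : Set
NF = ℤ × Bool

module Model (n : ℕ) .{{_ : NonZero n}} where

  private instance
    2n≢0 : NonZero (2 * n)
    2n≢0 = ℕₚ.m*n≢0 2 n

  infix  4 _≈ⁿ_
  infixl 7 _∙ⁿ_
  infix  8 _⁻¹ⁿ

  _≈ⁿ_ : NF → NF → Set
  x ≈ⁿ y = proj₁ x ≋ proj₁ y [ 2 * n ] × proj₂ x ≡ proj₂ y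

  -- Moving b to the right past aʲ inverts aʲ, and b² = aⁿ accounts for the summand `+ n` when both
  -- factors contain b.
  _∙ⁿ_ : NF → NF → NF
  (i , false) ∙ⁿ (j , f)     = i +ᶻ j , f
  (i , true)  ∙ⁿ (j , false) = i - j , true
  (i , true)  ∙ⁿ (j , true)  = i - j +ᶻ + n , false

  -- The second clause is b⁻¹a⁻ⁱ = aⁱb⁻¹, where b⁻¹ = aⁿb because b⁴ = 1.
  _⁻¹ⁿ : NF → NF
  (i , false) ⁻¹ⁿ = - i , false
  (i , true)  ⁻¹ⁿ = i +ᶻ + n , true

  ≈ⁿ-refl : ∀ {x} → x ≈ⁿ x
  ≈ⁿ-refl = ≋-refl , refl

  ≈ⁿ-sym : ∀ {x y} → x ≈ⁿ y → y ≈ⁿ x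
  ≈ⁿ-sym (p , q) = ≋-sym p , sym q

  ≈ⁿ-trans : ∀ {x y z} → x ≈ⁿ y → y ≈ⁿ z → x ≈ⁿ z
  ≈ⁿ-trans (p , q) (p′ , q′) = ≋-trans p p′ , trans q q′

  ≈ⁿ-reflexive : ∀ {i j e} → i ≡ j → (i , e) ≈ⁿ (j , e)
  ≈ⁿ-reflexive p = ≋-reflexive p , refl

  -- The modulus is written as a sum in ℤ so that, with `+ n` replaced by a variable ν, what remains
  -- to be checked is a ring identity.
  ≋-mod2n : ∀ {i j} k → i - j ≡ k *ᶻ (+ n +ᶻ + n) → i ≋ j [ 2 * n ]
  ≋-mod2n k eq = by-∣ (divides k (trans eq (cong (λ m → k *ᶻ + (n + m)) (sym (ℕₚ.+-identityʳ n)))))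

  ∙ⁿ-cong : ∀ {x x′ y y′} → x ≈ⁿ x′ → y ≈ⁿ y′ → x ∙ⁿ y ≈ⁿ x′ ∙ⁿ y′
  ∙ⁿ-cong {_ , false} {y = _ , f}     (p , refl) (q , refl) = +-cong-≋ p q , refl
  ∙ⁿ-cong {_ , true}  {y = _ , false} (p , refl) (q , refl) = +-cong-≋ p (neg-cong-≋ q) , refl
  ∙ⁿ-cong {_ , true}  {y = _ , true}  (p , refl) (q , refl) =
    +-cong-≋ (+-cong-≋ p (neg-cong-≋ q)) ≋-refl , refl

  ⁻¹ⁿ-cong : ∀ {x y} → x ≈ⁿ y → x ⁻¹ⁿ ≈ⁿ y ⁻¹ⁿ
  ⁻¹ⁿ-cong {_ , false} (p , refl) = neg-cong-≋ p , refl
  ⁻¹ⁿ-cong {_ , true}  (p , refl) = +-cong-≋ p ≋-refl , refl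

  ∙ⁿ-assoc : ∀ x y z → (x ∙ⁿ y) ∙ⁿ z ≈ⁿ x ∙ⁿ (y ∙ⁿ z)
  ∙ⁿ-assoc (i , false) (j , false) (k , _)     = ≈ⁿ-reflexive (ℤₚ.+-assoc i j k)
  ∙ⁿ-assoc (i , false) (j , true)  (k , false) = ≈ⁿ-reflexive (ℤₚ.+-assoc i j (- k))
  ∙ⁿ-assoc (i , false) (j , true)  (k , true)  = ≈ⁿ-reflexive (eq i j k (+ n))
    where
    eq : ∀ i j k ν → i +ᶻ j - k +ᶻ ν ≡ i +ᶻ (j - k +ᶻ ν)
    eq = solve-∀
  ∙ⁿ-assoc (i , true)  (j , false) (k , false) = ≈ⁿ-reflexive (eq i j k)
    where
    eq : ∀ i j k → i - j - k ≡ i - (j +ᶻ k)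
    eq = solve-∀
  ∙ⁿ-assoc (i , true)  (j , false) (k , true)  = ≈ⁿ-reflexive (eq i j k (+ n))
    where
    eq : ∀ i j k ν → i - j - k +ᶻ ν ≡ i - (j +ᶻ k) +ᶻ ν
    eq = solve-∀
  ∙ⁿ-assoc (i , true)  (j , true)  (k , false) = ≈ⁿ-reflexive (eq i j k (+ n))
    where
    eq : ∀ i j k ν → i - j +ᶻ ν +ᶻ k ≡ i - (j - k) +ᶻ ν
    eq = solve-∀
  -- The one case that uses a²ⁿ = 1: the factor aⁿ = b² is formed on different sides of a b, so the
  -- exponents differ by n - (-n) = 2n.
  ∙ⁿ-assoc (i , true)  (j , true)  (k , true)  = ≋-mod2n 1ℤ (eq i j k (+ n)) , refl
    where
    eq : ∀ i j k ν → (i - j +ᶻ ν +ᶻ k) - (i - (j - k +ᶻ ν)) ≡ 1ℤ *ᶻ (ν +ᶻ ν)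
    eq = solve-∀

  ∙ⁿ-identityˡ : ∀ x → (0ℤ , false) ∙ⁿ x ≈ⁿ x
  ∙ⁿ-identityˡ (i , _) = ≈ⁿ-reflexive (ℤₚ.+-identityˡ i)

  ∙ⁿ-identityʳ : ∀ x → x ∙ⁿ (0ℤ , false) ≈ⁿ x
  ∙ⁿ-identityʳ (i , false) = ≈ⁿ-reflexive (ℤₚ.+-identityʳ i)
  ∙ⁿ-identityʳ (i , true)  = ≈ⁿ-reflexive (ℤₚ.+-identityʳ i)

  ∙ⁿ-inverseˡ : ∀ x → x ⁻¹ⁿ ∙ⁿ x ≈ⁿ (0ℤ , false)
  ∙ⁿ-inverseˡ (i , false) = ≈ⁿ-reflexive (ℤₚ.+-inverseˡ i)
  ∙ⁿ-inverseˡ (i , true)  = ≋-mod2n 1ℤ (eq i (+ n)) , refl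
    where
    eq : ∀ i ν → i +ᶻ ν - i +ᶻ ν - 0ℤ ≡ 1ℤ *ᶻ (ν +ᶻ ν)
    eq = solve-∀

  ∙ⁿ-inverseʳ : ∀ x → x ∙ⁿ x ⁻¹ⁿ ≈ⁿ (0ℤ , false)
  ∙ⁿ-inverseʳ (i , false) = ≈ⁿ-reflexive (ℤₚ.+-inverseʳ i)
  ∙ⁿ-inverseʳ (i , true)  = ≈ⁿ-reflexive (eq i (+ n))
    where
    eq : ∀ i ν → i - (i +ᶻ ν) +ᶻ ν ≡ 0ℤ
    eq = solve-∀

  nf : Word QGen → NF
  nf (gen a) = 1ℤ , false
  nf (gen b) = 0ℤ , true
  nf 1ʷ      = 0ℤ , false
  nf (u · v) = nf u ∙ⁿ nf v
  nf (u ⁻¹ʷ) = nf u ⁻¹ⁿ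

  nf-^ : ∀ {w i} → nf w ≈ⁿ (i , false) → ∀ k → nf (w ^ʷ k) ≈ⁿ (+ k *ᶻ i , false)
  nf-^ {w} {i} p zero    = ≈ⁿ-reflexive (sym (ℤₚ.*-zeroˡ i))
  nf-^ {w} {i} p (suc k) =
    ≈ⁿ-trans (∙ⁿ-cong p (nf-^ {w} p k)) (≈ⁿ-reflexive (eq i (+ k)))
    where
    eq : ∀ i k → i +ᶻ k *ᶻ i ≡ (1ℤ +ᶻ k) *ᶻ i
    eq = solve-∀

  nf-a^ : ∀ k → nf (gen a ^ʷ k) ≈ⁿ (+ k , false)
  nf-a^ k = ≈ⁿ-trans (nf-^ {gen a} ≈ⁿ-refl k) (≈ⁿ-reflexive (ℤₚ.*-identityʳ (+ k)))

  open Group (Q₄ n) using (_≈_; setoid)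

  -- The model is a group satisfying the three defining relations, so evaluation factors through the
  -- presentation. This is what separates elements of `Q₄ n` later.
  nf-cong : ∀ {u v} → u ≈ v → nf u ≈ⁿ nf v
  nf-cong (rel a²ⁿ≈1)       = ≈ⁿ-trans (nf-a^ (2 * n)) (≋-mod2n 1ℤ eq , refl)
    where
    ring : ∀ ν → (ν +ᶻ ν) - 0ℤ ≡ 1ℤ *ᶻ (ν +ᶻ ν)
    ring = solve-∀
    eq : + (2 * n) - 0ℤ ≡ 1ℤ *ᶻ (+ n +ᶻ + n)
    eq = trans (cong (λ m → + (n + m) - 0ℤ) (ℕₚ.+-identityʳ n)) (ring (+ n))
  -- The left side, `nf (gen b ^ʷ 2)`, computes to `(+ n , false)`.
  nf-cong (rel b²≈aⁿ)       = ≈ⁿ-sym (nf-a^ n)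
  nf-cong (rel b⁻¹ab≈a⁻¹)   = ≋-mod2n 1ℤ (eq (+ n)) , refl
    where
    eq : ∀ ν → 0ℤ +ᶻ ν - 1ℤ - 0ℤ +ᶻ ν  - - 1ℤ ≡ 1ℤ *ᶻ (ν +ᶻ ν)
    eq = solve-∀
  nf-cong ≈-refl            = ≈ⁿ-refl
  nf-cong (≈-sym p)         = ≈ⁿ-sym (nf-cong p)
  nf-cong (≈-trans p q)     = ≈ⁿ-trans (nf-cong p) (nf-cong q)
  nf-cong (·-cong p q)      = ∙ⁿ-cong (nf-cong p) (nf-cong q)
  nf-cong (⁻¹-cong p)       = ⁻¹ⁿ-cong (nf-cong p)
  nf-cong (·-assoc u v w)   = ∙ⁿ-assoc (nf u) (nf v) (nf w)
  nf-cong (identityˡ u)     = ∙ⁿ-identityˡ (nf u)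
  nf-cong (identityʳ u)     = ∙ⁿ-identityʳ (nf u)
  nf-cong (inverseˡ u)      = ∙ⁿ-inverseˡ (nf u)
  nf-cong (inverseʳ u)      = ∙ⁿ-inverseʳ (nf u)

  -- From normal forms back to words, by means of the defining relations.

  open import Algebra.Properties.Group (Q₄ n) using (inverseˡ-unique; ⁻¹-anti-homo-∙)
  open SetoidReasoning setoid

  ^-+ : ∀ w k l → w ^ʷ (k + l) ≈ w ^ʷ k · w ^ʷ l
  ^-+ w zero    l = ≈-sym (identityˡ _)
  ^-+ w (suc k) l = ≈-trans (·-cong ≈-refl (^-+ w k l)) (≈-sym (·-assoc _ _ _))

  a^-multiple : ∀ q → gen a ^ʷ (q * (2 * n)) ≈ 1ʷ
  a^-multiple zero    = ≈-refl
  a^-multiple (suc q) = begin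
    gen a ^ʷ (2 * n + q * (2 * n))            ≈⟨ ^-+ (gen a) (2 * n) _ ⟩
    gen a ^ʷ (2 * n) · gen a ^ʷ (q * (2 * n)) ≈⟨ ·-cong (rel a²ⁿ≈1) (a^-multiple q) ⟩
    1ʷ · 1ʷ                                   ≈⟨ identityˡ 1ʷ ⟩
    1ʷ                                        ∎

  a^-% : ∀ k → gen a ^ʷ k ≈ gen a ^ʷ (k % (2 * n))
  a^-% k = begin
    gen a ^ʷ k                        ≡⟨ cong (gen a ^ʷ_) (m≡m%n+[m/n]*n k (2 * n)) ⟩
    gen a ^ʷ (k % (2 * n) + k / (2 * n) * (2 * n))
      ≈⟨ ^-+ (gen a) (k % (2 * n)) _ ⟩
    gen a ^ʷ (k % (2 * n)) · gen a ^ʷ (k / (2 * n) * (2 * n))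
      ≈⟨ ·-cong ≈-refl (a^-multiple (k / (2 * n))) ⟩
    gen a ^ʷ (k % (2 * n)) · 1ʷ       ≈⟨ identityʳ _ ⟩
    gen a ^ʷ (k % (2 * n))            ∎

  -- Exponents are reduced to their remainder, so congruent exponents give literally the same word;
  -- `word-cong` rests on this.
  a^ᶻ_ : ℤ → Word QGen
  a^ᶻ i = gen a ^ʷ (i %ℕ (2 * n))

  a^ᶻ-ℕ : ∀ {i} k → i ≋ + k [ 2 * n ] → a^ᶻ i ≈ gen a ^ʷ k
  a^ᶻ-ℕ {i} k p = begin
    a^ᶻ i                   ≡⟨ cong (gen a ^ʷ_) (%ℕ-cong (2 * n) p) ⟩
    gen a ^ʷ (k % (2 * n))  ≈⟨ a^-% k ⟨
    gen a ^ʷ k              ∎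

  a^ᶻ-+ : ∀ i j → a^ᶻ (i +ᶻ j) ≈ a^ᶻ i · a^ᶻ j
  a^ᶻ-+ i j = ≈-trans
    (a^ᶻ-ℕ _ (+-cong-≋ (≋-remainder (2 * n) i) (≋-remainder (2 * n) j)))
    (^-+ (gen a) (i %ℕ (2 * n)) (j %ℕ (2 * n)))

  a^ᶻ-neg : ∀ i → a^ᶻ (- i) ≈ (a^ᶻ i) ⁻¹ʷ
  a^ᶻ-neg i = inverseˡ-unique _ _ (≈-trans (≈-sym (a^ᶻ-+ (- i) i))
    (a^ᶻ-ℕ 0 (≋-reflexive (ℤₚ.+-inverseˡ i))))

  -- The conjugation relation gives ab = ba⁻¹; multiply this by a⁻¹ on the left and by a on the
  -- right.
  b·a≈a⁻¹·b : gen b · gen a ≈ gen a ⁻¹ʷ · gen b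
  b·a≈a⁻¹·b = begin
    gen b · gen a                                       ≈⟨ identityˡ _ ⟨
    1ʷ · (gen b · gen a)                                ≈⟨ ·-cong (inverseˡ (gen a)) ≈-refl ⟨
    gen a ⁻¹ʷ · gen a · (gen b · gen a)                 ≈⟨ ·-assoc _ _ _ ⟩
    gen a ⁻¹ʷ · (gen a · (gen b · gen a))               ≈⟨ ·-cong ≈-refl (·-assoc _ _ _) ⟨
    gen a ⁻¹ʷ · (gen a · gen b · gen a)                 ≈⟨ ·-cong ≈-refl (·-cong ab≈ba⁻¹ ≈-refl) ⟩
    gen a ⁻¹ʷ · (gen b · gen a ⁻¹ʷ · gen a)             ≈⟨ ·-cong ≈-refl (·-assoc _ _ _) ⟩
    gen a ⁻¹ʷ · (gen b · (gen a ⁻¹ʷ · gen a))           ≈⟨ ·-cong ≈-refl (·-cong ≈-refl (inverseˡ _)) ⟩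
    gen a ⁻¹ʷ · (gen b · 1ʷ)                            ≈⟨ ·-cong ≈-refl (identityʳ _) ⟩
    gen a ⁻¹ʷ · gen b                                   ∎
    where
    ab≈ba⁻¹ : gen a · gen b ≈ gen b · gen a ⁻¹ʷ
    ab≈ba⁻¹ = begin
      gen a · gen b                               ≈⟨ identityˡ _ ⟨
      1ʷ · (gen a · gen b)                        ≈⟨ ·-cong (inverseʳ (gen b)) ≈-refl ⟨
      gen b · gen b ⁻¹ʷ · (gen a · gen b)         ≈⟨ ·-assoc _ _ _ ⟩
      gen b · (gen b ⁻¹ʷ · (gen a · gen b))       ≈⟨ ·-cong ≈-refl (·-assoc _ _ _) ⟨
      gen b · (gen b ⁻¹ʷ · gen a · gen b)         ≈⟨ ·-cong ≈-refl (rel b⁻¹ab≈a⁻¹) ⟩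
      gen b · gen a ⁻¹ʷ                           ∎

  b·a^k≈a^-k·b : ∀ k → gen b · gen a ^ʷ k ≈ (gen a ^ʷ k) ⁻¹ʷ · gen b
  b·a^k≈a^-k·b zero    = begin
    gen b · 1ʷ       ≈⟨ identityʳ _ ⟩
    gen b            ≈⟨ identityˡ _ ⟨
    1ʷ · gen b       ≈⟨ ·-cong (inverseˡ-unique 1ʷ 1ʷ (identityˡ 1ʷ)) ≈-refl ⟩
    1ʷ ⁻¹ʷ · gen b   ∎
  b·a^k≈a^-k·b (suc k) = begin
    gen b · (gen a · aᵏ)                ≈⟨ ·-assoc _ _ _ ⟨
    gen b · gen a · aᵏ                  ≈⟨ ·-cong b·a≈a⁻¹·b ≈-refl ⟩
    gen a ⁻¹ʷ · gen b · aᵏ              ≈⟨ ·-assoc _ _ _ ⟩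
    gen a ⁻¹ʷ · (gen b · aᵏ)            ≈⟨ ·-cong ≈-refl (b·a^k≈a^-k·b k) ⟩
    gen a ⁻¹ʷ · (aᵏ ⁻¹ʷ · gen b)        ≈⟨ ·-assoc _ _ _ ⟨
    gen a ⁻¹ʷ · aᵏ ⁻¹ʷ · gen b          ≈⟨ ·-cong (⁻¹-anti-homo-∙ aᵏ (gen a)) ≈-refl ⟨
    (aᵏ · gen a) ⁻¹ʷ · gen b            ≈⟨ ·-cong (⁻¹-cong commute) ≈-refl ⟩
    (gen a · aᵏ) ⁻¹ʷ · gen b            ∎
    where
    aᵏ = gen a ^ʷ k
    commute : aᵏ · gen a ≈ gen a · aᵏ
    commute = begin
      aᵏ · gen a            ≈⟨ ·-cong ≈-refl (identityʳ _) ⟨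
      aᵏ · gen a ^ʷ 1       ≈⟨ ^-+ (gen a) k 1 ⟨
      gen a ^ʷ (k + 1)      ≡⟨ cong (gen a ^ʷ_) (ℕₚ.+-comm k 1) ⟩
      gen a · aᵏ            ∎

  b·a^ᶻ≈a^ᶻ-·b : ∀ i → gen b · a^ᶻ i ≈ a^ᶻ (- i) · gen b
  b·a^ᶻ≈a^ᶻ-·b i =
    ≈-trans (b·a^k≈a^-k·b (i %ℕ (2 * n))) (·-cong (≈-sym (a^ᶻ-neg i)) ≈-refl)

  b^ᵇ_ : Bool → Word QGen
  b^ᵇ false = 1ʷ
  b^ᵇ true  = gen b

  word : NF → Word QGen
  word (i , e) = a^ᶻ i · b^ᵇ e

  word-cong : ∀ {x y} → x ≈ⁿ y → word x ≈ word y
  word-cong {_ , e} (p , refl) =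
    ·-cong (≈-reflexive (cong (gen a ^ʷ_) (%ℕ-cong (2 * n) p))) ≈-refl
    where open Group (Q₄ n) using () renaming (reflexive to ≈-reflexive)

  -- Each case collects the powers of a on the left with `b·a^ᶻ≈a^ᶻ-·b`; two copies of b merge into
  -- aⁿ.
  word-∙ⁿ : ∀ x y → word (x ∙ⁿ y) ≈ word x · word y
  word-∙ⁿ (i , false) (j , f) = begin
    a^ᶻ (i +ᶻ j) · b^ᵇ f             ≈⟨ ·-cong (a^ᶻ-+ i j) ≈-refl ⟩
    a^ᶻ i · a^ᶻ j · b^ᵇ f            ≈⟨ ·-assoc _ _ _ ⟩
    a^ᶻ i · (a^ᶻ j · b^ᵇ f)          ≈⟨ ·-cong (identityʳ _) ≈-refl ⟨
    a^ᶻ i · 1ʷ · (a^ᶻ j · b^ᵇ f)     ∎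
  word-∙ⁿ (i , true) (j , false) = begin
    a^ᶻ (i - j) · gen b              ≈⟨ ·-cong (a^ᶻ-+ i (- j)) ≈-refl ⟩
    a^ᶻ i · a^ᶻ (- j) · gen b        ≈⟨ ·-assoc _ _ _ ⟩
    a^ᶻ i · (a^ᶻ (- j) · gen b)      ≈⟨ ·-cong ≈-refl (b·a^ᶻ≈a^ᶻ-·b j) ⟨
    a^ᶻ i · (gen b · a^ᶻ j)          ≈⟨ ·-assoc _ _ _ ⟨
    a^ᶻ i · gen b · a^ᶻ j            ≈⟨ ·-cong ≈-refl (identityʳ _) ⟨
    a^ᶻ i · gen b · (a^ᶻ j · 1ʷ)     ∎
  word-∙ⁿ (i , true) (j , true) = begin
    a^ᶻ (i - j +ᶻ + n) · 1ʷ                ≈⟨ identityʳ _ ⟩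
    a^ᶻ (i - j +ᶻ + n)                     ≈⟨ a^ᶻ-+ (i - j) (+ n) ⟩
    a^ᶻ (i - j) · a^ᶻ (+ n)                ≈⟨ ·-cong (a^ᶻ-+ i (- j)) a^ᶻn≈b·b ⟩
    a^ᶻ i · a^ᶻ (- j) · (gen b · gen b)    ≈⟨ ·-assoc _ _ _ ⟩
    a^ᶻ i · (a^ᶻ (- j) · (gen b · gen b))  ≈⟨ ·-cong ≈-refl (·-assoc _ _ _) ⟨
    a^ᶻ i · (a^ᶻ (- j) · gen b · gen b)    ≈⟨ ·-cong ≈-refl (·-cong (b·a^ᶻ≈a^ᶻ-·b j) ≈-refl) ⟨
    a^ᶻ i · (gen b · a^ᶻ j · gen b)        ≈⟨ ·-cong ≈-refl (·-assoc _ _ _) ⟩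
    a^ᶻ i · (gen b · (a^ᶻ j · gen b))      ≈⟨ ·-assoc _ _ _ ⟨
    a^ᶻ i · gen b · (a^ᶻ j · gen b)        ∎
    where
    a^ᶻn≈b·b : a^ᶻ (+ n) ≈ gen b · gen b
    a^ᶻn≈b·b = begin
      a^ᶻ (+ n)              ≈⟨ a^ᶻ-ℕ n ≋-refl ⟩
      gen a ^ʷ n             ≈⟨ rel b²≈aⁿ ⟨
      gen b · (gen b · 1ʷ)   ≈⟨ ·-cong ≈-refl (identityʳ _) ⟩
      gen b · gen b          ∎

  word-ε : word (0ℤ , false) ≈ 1ʷ
  word-ε = ≈-trans (identityʳ _) (a^ᶻ-ℕ 0 ≋-refl)

  word-⁻¹ⁿ : ∀ x → word (x ⁻¹ⁿ) ≈ word x ⁻¹ʷ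
  word-⁻¹ⁿ x = inverseˡ-unique _ _ (begin
    word (x ⁻¹ⁿ) · word x   ≈⟨ word-∙ⁿ (x ⁻¹ⁿ) x ⟨
    word (x ⁻¹ⁿ ∙ⁿ x)       ≈⟨ word-cong (∙ⁿ-inverseˡ x) ⟩
    word (0ℤ , false)       ≈⟨ word-ε ⟩
    1ʷ                      ∎)

  -- Both `nf` and `word` are multiplicative, so only the generators need a computation. Hence the
  -- relations reduce every word to a normal form, and the model is all of `Q₄ n`.
  word-nf : ∀ w → word (nf w) ≈ w
  word-nf (gen a) = ≈-trans (identityʳ _) (≈-trans (a^ᶻ-ℕ 1 ≋-refl) (identityʳ _))
  word-nf (gen b) = ≈-trans (·-cong (a^ᶻ-ℕ 0 ≋-refl) ≈-refl) (identityˡ _)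
  word-nf 1ʷ      = word-ε
  word-nf (u · v) = ≈-trans (word-∙ⁿ (nf u) (nf v)) (·-cong (word-nf u) (word-nf v))
  word-nf (w ⁻¹ʷ) = ≈-trans (word-⁻¹ⁿ (nf w)) (⁻¹-cong (word-nf w))

  nf-word : ∀ x → nf (word x) ≈ⁿ x
  nf-word (i , e) = ≈ⁿ-trans (∙ⁿ-cong nf-a^ᶻ (≈ⁿ-refl {nf (b^ᵇ e)})) (append e)
    where
    nf-a^ᶻ : nf (a^ᶻ i) ≈ⁿ (i , false)
    nf-a^ᶻ = ≈ⁿ-trans (nf-a^ (i %ℕ (2 * n))) (≋-sym (≋-remainder (2 * n) i) , refl)
    append : ∀ e → (i , false) ∙ⁿ nf (b^ᵇ e) ≈ⁿ (i , e)
    append false = ≈ⁿ-reflexive (ℤₚ.+-identityʳ i)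
    append true  = ≈ⁿ-reflexive (ℤₚ.+-identityʳ i)

  nf-injective : ∀ {u v} → nf u ≈ⁿ nf v → u ≈ v
  nf-injective {u} {v} p = begin
    u             ≈⟨ word-nf u ⟨
    word (nf u)   ≈⟨ word-cong p ⟩
    word (nf v)   ≈⟨ word-nf v ⟩
    v             ∎

  -- Connection sets and digraph isomorphisms in terms of normal forms.

  record NFSet : Set₁ where
    field
      P      : NF → Set
      P?     : Decidable P
      P-resp : ∀ {x y} → x ≈ⁿ y → P x → P y
      ε∉P    : ¬ P (0ℤ , false)

    connectionSet : ConnectionSet (Q₄ n)
    connectionSet = record
      { Mem      = λ w → P (nf w)
      ; Mem?     = λ w → P? (nf w)
      ; Mem-resp = λ u≈v → P-resp (nf-cong u≈v)
      ; ε∉       = ε∉P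
      }

  open NFSet

  nf-involution⇒≅ : ∀ S T (F : NF → NF) →
    (∀ {x y} → x ≈ⁿ y → F x ≈ⁿ F y) → (∀ x → F (F x) ≈ⁿ x) →
    (∀ x y → P S (y ∙ⁿ x ⁻¹ⁿ) → P T (F y ∙ⁿ F x ⁻¹ⁿ)) →
    (∀ x y → P T (y ∙ⁿ x ⁻¹ⁿ) → P S (F y ∙ⁿ F x ⁻¹ⁿ)) →
    Cay (Q₄ n) (connectionSet S) ≅ Cay (Q₄ n) (connectionSet T)
  nf-involution⇒≅ S T F F-cong F-inv S⇒T T⇒S =
    involution⇒≅ (Q₄ n) (connectionSet S) (connectionSet T) f
      (λ g≈h → word-cong (F-cong (nf-cong g≈h)))
      (λ g → nf-injective (≈ⁿ-trans (nf-word _) (≈ⁿ-trans (F-cong (nf-word _)) (F-inv (nf g)))))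
      (λ g h → unword T g h ∘ S⇒T (nf g) (nf h))
      (λ g h → unword S g h ∘ T⇒S (nf g) (nf h))
    where
    f : Word QGen → Word QGen
    f w = word (F (nf w))
    unword : ∀ S g h → P S (F (nf h) ∙ⁿ F (nf g) ⁻¹ⁿ) → P S (nf (f h · f g ⁻¹ʷ))
    unword S g h = P-resp S (∙ⁿ-cong (≈ⁿ-sym (nf-word (F (nf h))))
                                     (⁻¹ⁿ-cong (≈ⁿ-sym (nf-word (F (nf g))))))

  -- For e = `true` the n from the inverse cancels the n from b² already in ℤ. The equality is
  -- therefore propositional and available to `rewrite`.
  quotient-same : ∀ i j e → (j , e) ∙ⁿ (i , e) ⁻¹ⁿ ≡ (j - i , false)
  quotient-same i j false = refl
  quotient-same i j true  = cong (_, false) (eq i j (+ n))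
    where
    eq : ∀ i j ν → j - (i +ᶻ ν) +ᶻ ν ≡ j - i
    eq = solve-∀

  quotient-in-⟨a⟩ : ∀ x y → proj₂ (y ∙ⁿ x ⁻¹ⁿ) ≡ false → proj₂ y ≡ proj₂ x
  quotient-in-⟨a⟩ (_ , false) (_ , false) _ = refl
  quotient-in-⟨a⟩ (_ , true)  (_ , true)  _ = refl

  ∙ⁿ-comm-⟨a⟩ : ∀ x y → proj₂ x ≡ false → proj₂ y ≡ false → x ∙ⁿ y ≈ⁿ y ∙ⁿ x
  ∙ⁿ-comm-⟨a⟩ (i , false) (j , false) refl refl = ≈ⁿ-reflexive (ℤₚ.+-comm i j)

-- Parity of integers.

bit : Bool → ℤ
bit false = 0ℤ
bit true  = 1ℤ

parity : ℤ → Bool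
parity i = (i %ℕ 2) ≡ᵇ 1

≋-parity : ∀ i → i ≋ bit (parity i) [ 2 ]
≋-parity i = ≋-trans (≋-remainder 2 i) (≋-reflexive (digit (n%ℕd<d i 2)))
  where
  digit : ∀ {r} → r < 2 → + r ≡ bit (r ≡ᵇ 1)
  digit {0}           _ = refl
  digit {1}           _ = refl
  digit {suc (suc _)} (s<s (s<s ()))

parity-cong : ∀ {i j} → i ≋ j [ 2 ] → parity i ≡ parity j
parity-cong p = cong (_≡ᵇ 1) (%ℕ-cong 2 p)

parity-bit : ∀ e → parity (bit e) ≡ e
parity-bit false = refl
parity-bit true  = refl

parity-injective : ∀ {i j} → parity i ≡ parity j → i ≋ j [ 2 ]
parity-injective {i} {j} p =
  ≋-trans (≋-parity i) (≋-trans (≋-reflexive (cong bit p)) (≋-sym (≋-parity j)))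

-- Even n: the complements of ⟨a⟩ and of ⟨a², b⟩.

module Even (n : ℕ) .{{_ : NonZero n}} (2∣n : 2 ∣ n) where
  open Model n

  -- Signs do not matter modulo 2, and the extra summand n vanishes as n is even. So the parity of
  -- the exponent of a is a homomorphism, with kernel ⟨a², b⟩.
  quotient-mod2 : ∀ x y → proj₁ (y ∙ⁿ x ⁻¹ⁿ) ≋ proj₁ y - proj₁ x [ 2 ]
  quotient-mod2 (i , false) (j , false) = ≋-refl
  quotient-mod2 (i , true)  (j , true)  = ≋-reflexive (cong proj₁ (quotient-same i j true))
  quotient-mod2 (i , false) (j , true)  = by-∣ (divides i (eq i j))
    where
    eq : ∀ i j → (j - - i) - (j - i) ≡ i *ᶻ + 2
    eq = solve-∀
  quotient-mod2 (i , true)  (j , false) = ≋-trans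
    (+-cong-≋ (≋-refl {i = j}) (+-cong-≋ (≋-refl {i = i}) n≋0))
    (by-∣ (divides i (eq i j)))
    where
    n≋0 : + n ≋ 0ℤ [ 2 ]
    n≋0 = by-∣ (subst (+ 2 ∣ᶻ_) (sym (ℤₚ.+-identityʳ (+ n))) (∣ᵤ⇒∣ 2∣n))
    eq : ∀ i j → (j +ᶻ (i +ᶻ 0ℤ)) - (j - i) ≡ i *ᶻ + 2
    eq = solve-∀

  outside⟨a⟩ : NFSet
  outside⟨a⟩ = record
    { P      = λ x → proj₂ x ≢ false
    ; P?     = λ x → ¬? (proj₂ x ≟ false)
    ; P-resp = λ { (_ , refl) x∈ → x∈ }
    ; ε∉P    = λ ε∈ → ε∈ refl
    }

  ≈ⁿ⇒parity≡ : ∀ {x y} → x ≈ⁿ y → parity (proj₁ x) ≡ parity (proj₁ y)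
  ≈ⁿ⇒parity≡ (p , _) = parity-cong (≋-weaken (m∣m*n n) p)

  outside⟨a²,b⟩ : NFSet
  outside⟨a²,b⟩ = record
    { P      = λ x → parity (proj₁ x) ≢ false
    ; P?     = λ x → ¬? (parity (proj₁ x) ≟ false)
    ; P-resp = λ x≈y x∈ y∉ → x∈ (trans (≈ⁿ⇒parity≡ x≈y) y∉)
    ; ε∉P    = λ ε∈ → ε∈ refl
    }

  -- Exchanges the cosets of ⟨a⟩ and of ⟨a², b⟩ by trading e for the parity of i.
  swap : NF → NF
  swap (i , e) = i - bit (parity i) +ᶻ bit e , parity i

  -- Subtracting its own parity bit makes i even, so the added `bit e` alone decides.
  parity-swap : ∀ x → parity (proj₁ (swap x)) ≡ proj₂ x
  parity-swap (i , e) = trans (parity-cong p) (parity-bit e)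
    where
    cancel : ∀ i j → i - i +ᶻ j ≡ j
    cancel = solve-∀
    p : i - bit (parity i) +ᶻ bit e ≋ bit e [ 2 ]
    p = ≋-trans (+-cong-≋ (+-cong-≋ (≋-parity i) ≋-refl) ≋-refl)
                (≋-reflexive (cancel (bit (parity i)) (bit e)))

  swap-cong : ∀ {x y} → x ≈ⁿ y → swap x ≈ⁿ swap y
  swap-cong {i , e} {j , _} i≈j@(p , refl) =
    +-cong-≋ (+-cong-≋ p (≋-reflexive (cong (-_ ∘ bit) q))) ≋-refl , q
    where
    q : parity i ≡ parity j
    q = ≈ⁿ⇒parity≡ {i , e} {j , e} i≈j

  swap-involutive : ∀ x → swap (swap x) ≈ⁿ x
  swap-involutive (i , e) =
    ≋-reflexive (trans (cong (λ f → k - bit f +ᶻ bit (parity i)) (parity-swap (i , e)))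
                       (cancel i (bit (parity i)) (bit e)))
    , parity-swap (i , e)
    where
    k : ℤ
    k = proj₁ (swap (i , e))
    cancel : ∀ i p e → i - p +ᶻ e - e +ᶻ p ≡ i
    cancel = solve-∀

  -- By contraposition: if the images share a coset of ⟨a², b⟩, their exponents have equal parity,
  -- which by `parity-swap` means that x and y share a coset of ⟨a⟩.
  swap-outside⟨a⟩ : ∀ x y → proj₂ (y ∙ⁿ x ⁻¹ⁿ) ≢ false →
                    parity (proj₁ (swap y ∙ⁿ swap x ⁻¹ⁿ)) ≢ false
  swap-outside⟨a⟩ x@(i , e) y@(j , f) ∉⟨a⟩ p = ∉⟨a⟩ (same e≡f)
    where
    swapped : proj₁ (swap y) ≋ proj₁ (swap x) [ 2 ]
    swapped = ≋-difference (≋-trans (≋-sym (quotient-mod2 (swap x) (swap y)))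
                                    (parity-injective p))
    e≡f : f ≡ e
    e≡f = trans (sym (parity-swap y)) (trans (parity-cong swapped) (parity-swap x))
    same : f ≡ e → proj₂ (y ∙ⁿ x ⁻¹ⁿ) ≡ false
    same refl = cong proj₂ (quotient-same i j e)

  swap-outside⟨a²,b⟩ : ∀ x y → parity (proj₁ (y ∙ⁿ x ⁻¹ⁿ)) ≢ false →
                       proj₂ (swap y ∙ⁿ swap x ⁻¹ⁿ) ≢ false
  swap-outside⟨a²,b⟩ x@(i , _) y@(j , _) ∉⟨a²,b⟩ p = ∉⟨a²,b⟩
    (parity-cong (≋-trans (quotient-mod2 x y) (≋-trans (+-cong-≋ j≋i ≋-refl)
                                                       (≋-reflexive (ℤₚ.+-inverseʳ i)))))
    where
    j≋i : j ≋ i [ 2 ]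
    j≋i = parity-injective (quotient-in-⟨a⟩ (swap x) (swap y) p)

  open NFSet
  open Group (Q₄ n) using (_≈_; rawGroup)
  open GroupMorphisms rawGroup rawGroup using (IsGroupIsomorphism; module IsGroupIsomorphism)

  -- Such a σ would carry ⟨a², b⟩ into ⟨a⟩, so the images of a² and b would commute, and by
  -- injectivity a² and b themselves.
  not-equivalent : 3 ≤ n → ∀ σ → IsGroupIsomorphism σ →
    ¬ (∀ t → P outside⟨a⟩ (nf t) ⇔ (∃[ s ] (P outside⟨a²,b⟩ (nf s) × t ≈ σ s)))
  not-equivalent 3≤n σ isIso T⇔σS = ℕₚ.<⇒≱ 3≤n (ℕₚ.*-cancelˡ-≤ 2 (∣⇒≤ 2n∣4))
    where
    open IsGroupIsomorphism isIso

    σ∈⟨a⟩ : ∀ w → parity (proj₁ (nf w)) ≡ false → proj₂ (nf (σ w)) ≡ false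
    -- Were σ w outside ⟨a⟩, it would equal σ s for some s outside ⟨a², b⟩, and then w = s.
    σ∈⟨a⟩ w w∉S = decidable-stable (_ ≟ false) λ σw∈T →
      let s , s∈S , σw≈σs = Equivalence.to (T⇔σS (σ w)) σw∈T
      in s∈S (trans (sym (≈ⁿ⇒parity≡ (nf-cong (injective σw≈σs)))) w∉S)

    a² = gen a ^ʷ 2

    a²b≈ba² : a² · gen b ≈ gen b · a²
    a²b≈ba² = injective (≈-trans (∙-homo a² (gen b)) (≈-trans
      (nf-injective (∙ⁿ-comm-⟨a⟩ (nf (σ a²)) (nf (σ (gen b)))
        (σ∈⟨a⟩ a² refl) (σ∈⟨a⟩ (gen b) refl)))
      (≈-sym (∙-homo (gen b) a²))))

    -- The normal forms of a²b and ba² have exponents 2 and -2.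
    2n∣4 : 2 * n ∣ 4
    2n∣4 = -≋⇒∣+ {x = 2} {y = 2} (proj₁ (nf-cong a²b≈ba²))

  ¬DCI : 3 ≤ n → ¬ IsDCI (Q₄ n)
  ¬DCI 3≤n dci =
    let σ , isIso , T⇔σS = dci (connectionSet outside⟨a²,b⟩) (connectionSet outside⟨a⟩)
          (nf-involution⇒≅ outside⟨a⟩ outside⟨a²,b⟩ swap swap-cong swap-involutive
            swap-outside⟨a⟩ swap-outside⟨a²,b⟩)
    in not-equivalent 3≤n σ isIso T⇔σS

-- A square divisor d² of n with d ≥ 3: the coset a⟨aᴹ⟩ with aᴹ or a⁻ᴹ adjoined.

module NonSquareFree (n M d : ℕ) .{{_ : NonZero n}} .{{_ : NonZero M}}
  (2n≡dM : 2 * n ≡ d * M) (d∣M : d ∣ M) (3≤d : 3 ≤ d) where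
  open Model n

  2n≡dMᶻ : + (2 * n) ≡ + d *ᶻ + M
  2n≡dMᶻ = trans (cong +_ 2n≡dM) (ℤₚ.pos-* d M)

  d∤1 : ¬ d ∣ 1
  d∤1 d∣1 = ℕₚ.<⇒≱ 3≤d (ℕₚ.m≤n⇒m≤1+n (∣⇒≤ d∣1))

  2n∣k*M⇒d∣k : ∀ k → 2 * n ∣ k * M → d ∣ k
  2n∣k*M⇒d∣k k p = *-cancelʳ-∣ M (subst (_∣ k * M) 2n≡dM p)

  2n∤M : ¬ 2 * n ∣ M
  2n∤M p = d∤1 (2n∣k*M⇒d∣k 1 (subst (2 * n ∣_) (sym (ℕₚ.*-identityˡ M)) p))

  M∤1 : ¬ M ∣ 1
  M∤1 M∣1 = d∤1 (∣-trans d∣M M∣1)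

  ≋-mod2n⇒M : ∀ {i j} → i ≋ j [ 2 * n ] → i ≋ j [ M ]
  ≋-mod2n⇒M = ≋-weaken (ℕ∣.divides d 2n≡dM)

  -- The first alternative describes the exponents in a⟨aᴹ⟩, since M divides 2n; the second adjoins
  -- aᶜ, with c later M or -M.
  Step : ℤ → ℤ → Set
  Step c k = k ≋ 1ℤ [ M ] ⊎ k ≋ c [ 2 * n ]

  StepSet : ℤ → NF → Set
  StepSet c x = proj₂ x ≡ false × Step c (proj₁ x)

  stepSet : ∀ c → ¬ 0ℤ ≋ c [ 2 * n ] → NFSet
  stepSet c 0≭c = record
    { P      = StepSet c
    ; P?     = λ x → (proj₂ x ≟ false) ×-dec (≋-dec M _ _ ⊎-dec ≋-dec (2 * n) _ _)
    ; P-resp = λ { (p , refl) (e , k) →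
        e , Sum.map (≋-trans (≋-sym (≋-mod2n⇒M p))) (≋-trans (≋-sym p)) k }
    ; ε∉P    = λ { (_ , inj₁ p) → M∤1 (≋0⇒∣ (≋-sym p))
                 ; (_ , inj₂ p) → 0≭c p }
    }

  -- r + qM ↦ r - qM for 0 ≤ r < M: this fixes every residue class modulo M and
  -- exchanges the steps M and -M.
  reflect : ℤ → ℤ
  reflect i = + (i %ℕ M) +ᶻ + (i %ℕ M) - i

  reflect-modM : ∀ i → reflect i ≋ i [ M ]
  reflect-modM i = ≋-trans
    (+-cong-≋ (+-cong-≋ (≋-sym (≋-remainder M i)) (≋-sym (≋-remainder M i))) ≋-refl)
    (≋-reflexive (cancel i))
    where
    cancel : ∀ i → i +ᶻ i - i ≡ i
    cancel = solve-∀

  -- Both exponents have the same remainder r modulo M, and the terms r + r cancel.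
  reflect-difference : ∀ {i j} → i ≋ j [ M ] → reflect i - reflect j ≡ - (i - j)
  reflect-difference {i} {j} p =
    trans (cong (λ r → + r +ᶻ + r - i - reflect j) (%ℕ-cong M p)) (cancel (+ (j %ℕ M)) i j)
    where
    cancel : ∀ r i j → (r +ᶻ r - i) - (r +ᶻ r - j) ≡ - (i - j)
    cancel = solve-∀

  reflect-cong : ∀ {i j} → i ≋ j [ 2 * n ] → reflect i ≋ reflect j [ 2 * n ]
  reflect-cong p = +-cong-≋ (≋-reflexive (cong (λ r → + r +ᶻ + r) (%ℕ-cong M (≋-mod2n⇒M p))))
                            (neg-cong-≋ p)

  reflect-involutive : ∀ i → reflect (reflect i) ≡ i
  reflect-involutive i =
    trans (cong (λ r → + r +ᶻ + r - reflect i) (%ℕ-cong M (reflect-modM i)))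
          (cancel (+ (i %ℕ M)) i)
    where
    cancel : ∀ r i → r +ᶻ r - (r +ᶻ r - i) ≡ i
    cancel = solve-∀

  -- Steps congruent to 1 modulo M survive because `reflect` fixes residue classes modulo M. A step
  -- c stays inside one class, as M divides c, and there `reflect` negates differences.
  reflect-step : ∀ {c} → c ≋ 0ℤ [ M ] → ∀ i j →
                 Step c (j - i) → Step (- c) (reflect j - reflect i)
  reflect-step c≋0 i j (inj₁ p) = inj₁
    (≋-trans (+-cong-≋ (reflect-modM j) (neg-cong-≋ (reflect-modM i))) p)
  reflect-step c≋0 i j (inj₂ p) = inj₂
    (≋-trans (≋-reflexive (reflect-difference {j} {i} (≋-difference (≋-trans (≋-mod2n⇒M p) c≋0))))
             (neg-cong-≋ p))

  mirror : NF → NF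
  mirror (i , e) = reflect i , e

  mirror-step : ∀ {c} → c ≋ 0ℤ [ M ] → ∀ x y →
    StepSet c (y ∙ⁿ x ⁻¹ⁿ) → StepSet (- c) (mirror y ∙ⁿ mirror x ⁻¹ⁿ)
  mirror-step c≋0 (i , e) (j , f) (p , step) with quotient-in-⟨a⟩ (i , e) (j , f) p
  -- Both ends lie in one coset of ⟨a⟩, so the two quotients are plain differences of exponents.
  ... | refl rewrite quotient-same i j e | quotient-same (reflect i) (reflect j) e =
    refl , reflect-step c≋0 i j step

  S T : NFSet
  S = stepSet (+ M) (2n∤M ∘ ≋0⇒∣ ∘ ≋-sym)
  T = stepSet (- + M) (2n∤M ∘ -≋⇒∣+)

  M≋0 : + M ≋ 0ℤ [ M ]
  M≋0 = by-∣ (divides 1ℤ (eq (+ M)))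
    where
    eq : ∀ μ → μ - 0ℤ ≡ 1ℤ *ᶻ μ
    eq = solve-∀

  open NFSet

  CayT≅CayS : Cay (Q₄ n) (connectionSet T) ≅ Cay (Q₄ n) (connectionSet S)
  CayT≅CayS = nf-involution⇒≅ T S mirror
    (λ { (p , refl) → reflect-cong p , refl })
    (λ { (i , e) → ≈ⁿ-reflexive (reflect-involutive i) })
    -- Starting from c = -M, the mirrored step is -(-M), which has to be turned into M.
    (λ x y p → subst (λ c → StepSet c (mirror y ∙ⁿ mirror x ⁻¹ⁿ)) (ℤₚ.neg-involutive (+ M))
                     (mirror-step (neg-cong-≋ M≋0) x y p))
    (mirror-step M≋0)

  open Group (Q₄ n) using (_≈_; rawGroup)
  open GroupMorphisms rawGroup rawGroup using (IsGroupIsomorphism; module IsGroupIsomorphism)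

  not-equivalent : ∀ σ → IsGroupIsomorphism σ →
    ¬ (∀ t → P T (nf t) ⇔ (∃[ s ] (P S (nf s) × t ≈ σ s)))
  not-equivalent σ isIso T⇔σS = impossible (proj₂ (σ-S⊆T (gen a) (refl , inj₁ ≋-refl)))
    where
    open IsGroupIsomorphism isIso

    σ-S⊆T : ∀ s → P S (nf s) → P T (nf (σ s))
    σ-S⊆T s s∈S = Equivalence.from (T⇔σS (σ s)) (s , s∈S , ≈-refl)

    σ-^ : ∀ w k → σ (w ^ʷ k) ≈ σ w ^ʷ k
    σ-^ w zero    = ε-homo
    σ-^ w (suc k) = ≈-trans (∙-homo w (w ^ʷ k)) (·-cong ≈-refl (σ-^ w k))

    r : ℤ
    r = proj₁ (nf (σ (gen a)))

    nf-σa^ : ∀ k → nf (σ (gen a ^ʷ k)) ≈ⁿ (+ k *ᶻ r , false)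
    nf-σa^ k = ≈ⁿ-trans (nf-cong (σ-^ (gen a) k))
      (nf-^ {σ (gen a)} (≋-refl , proj₁ (σ-S⊆T (gen a) (refl , inj₁ ≋-refl))) k)

    M∤ : ¬ Step (- + M) (+ M)
    M∤ (inj₁ p) = M∤1 (≋0⇒∣ (≋-trans (≋-sym p) M≋0))
    -- M ≡ -M modulo 2n = dM would give d ∣ 2. For d = 2 the elements aᴹ and a⁻ᴹ would indeed
    -- coincide.
    M∤ (inj₂ p) = ℕₚ.<⇒≱ 3≤d (∣⇒≤ (2n∣k*M⇒d∣k 2
      (subst (2 * n ∣_) (cong (λ k → M + k) (sym (ℕₚ.+-identityʳ M))) (-≋⇒∣+ p))))

    impossible : ¬ Step (- + M) r
    -- Here r = 1 + kM, so σ fixes aᴹ. As aᴹ is in S, it would be in T as well, against `M∤`.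
    impossible (inj₁ (by-∣ (divides k r-1≡kM))) =
      M∤ (proj₂ (P-resp T (≈ⁿ-trans (nf-σa^ M) (M*r≋M , refl))
                 (σ-S⊆T (gen a ^ʷ M) (P-resp S (≈ⁿ-sym (nf-a^ M)) (refl , inj₂ ≋-refl)))))
      where
      M*r≋M : + M *ᶻ r ≋ + M [ 2 * n ]
      -- With M = ed, the difference Mr - M = kM² equals ke · dM = ke · 2n.
      M*r≋M = by-∣ (divides (k *ᶻ + e) (begin
        + M *ᶻ r - + M              ≡⟨ factor (+ M) r ⟩
        + M *ᶻ (r - 1ℤ)             ≡⟨ cong (+ M *ᶻ_) r-1≡kM ⟩
        + M *ᶻ (k *ᶻ + M)           ≡⟨ cong (_*ᶻ (k *ᶻ + M)) (trans (cong +_ M≡ed) (ℤₚ.pos-* e d)) ⟩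
        + e *ᶻ + d *ᶻ (k *ᶻ + M)    ≡⟨ regroup (+ e) (+ d) k (+ M) ⟩
        k *ᶻ + e *ᶻ (+ d *ᶻ + M)    ≡⟨ cong (k *ᶻ + e *ᶻ_) 2n≡dMᶻ ⟨
        k *ᶻ + e *ᶻ + (2 * n)       ∎))
        where
        open ≡-Reasoning
        open ℕ∣._∣_ d∣M renaming (quotient to e; equality to M≡ed)
        factor : ∀ μ r → μ *ᶻ r - μ ≡ μ *ᶻ (r - 1ℤ)
        factor = solve-∀
        regroup : ∀ e d k μ → e *ᶻ d *ᶻ (k *ᶻ μ) ≡ k *ᶻ e *ᶻ (d *ᶻ μ)
        regroup = solve-∀
    -- Here σ(a) = a⁻ᴹ, whose d-th power is trivial. Injectivity gives aᵈ = 1, so 2n ∣ d ∣ M.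
    impossible (inj₂ p) = 2n∤M (∣-trans 2n∣d d∣M)
      where
      d*-M≋0 : + d *ᶻ - + M ≋ 0ℤ [ 2 * n ]
      d*-M≋0 = by-∣ (divides -1ℤ (trans (eq (+ d) (+ M)) (cong (-1ℤ *ᶻ_) (sym 2n≡dMᶻ))))
        where
        eq : ∀ d μ → d *ᶻ - μ - 0ℤ ≡ -1ℤ *ᶻ (d *ᶻ μ)
        eq = solve-∀
      a^d≈1 : gen a ^ʷ d ≈ 1ʷ
      a^d≈1 = injective (≈-trans
        (nf-injective (≈ⁿ-trans (nf-σa^ d) (≋-trans (*-congˡ-≋ (+ d) p) d*-M≋0 , refl)))
        (≈-sym ε-homo))
      2n∣d : 2 * n ∣ d
      2n∣d = ≋0⇒∣ (proj₁ (≈ⁿ-trans (≈ⁿ-sym (nf-a^ d)) (nf-cong a^d≈1)))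

  ¬DCI : ¬ IsDCI (Q₄ n)
  ¬DCI dci =
    let σ , isIso , T⇔σS = dci (connectionSet S) (connectionSet T) CayT≅CayS
    in not-equivalent σ isIso T⇔σS

-- Reduction of oddness and square-freeness to the two constructions.

corollary1p2 : (n : ℕ) → 3 ≤ n → IsDCI (Q₄ n) → Odd n × SquareFree n
corollary1p2 n 3≤n dci = odd , squareFree
  where
  instance
    n≢0 : NonZero n
    n≢0 = >-nonZero (ℕₚ.≤-trans (s≤s z≤n) 3≤n)

  odd : Odd n
  odd 2∣n = Even.¬DCI n 2∣n 3≤n dci

  squareFree : SquareFree n
  squareFree 0 0∣n   = contradiction (0∣⇒≡0 0∣n) (≢-nonZero⁻¹ n)
  squareFree 1 _     = refl
  -- The construction for square divisors starts at d = 3; for d = 2 the number n is even, which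
  -- `odd` excludes.
  squareFree 2 4∣n   = contradiction (∣-trans (ℕ∣.divides 2 refl) 4∣n) odd
  squareFree d@(suc (suc (suc _))) (ℕ∣.divides q n≡qd²) =
    contradiction dci (NonSquareFree.¬DCI n M d 2n≡dM (n∣m*n (2 * q)) (s≤s (s≤s (s≤s z≤n))))
    where
    -- This is 2n/d for n = qd²; the second factor d of the square remains visible, which gives d ∣
    -- M.
    M = 2 * q * d
    regroup : ∀ q d → 2 * (q * (d * d)) ≡ d * (2 * q * d)
    regroup = ℕ-solve-∀
    2n≡dM : 2 * n ≡ d * M
    2n≡dM = trans (cong (2 *_) n≡qd²) (regroup q d)
    instance
      M≢0 : NonZero M
      M≢0 = ℕₚ.m*n≢0⇒n≢0 d {{subst NonZero 2n≡dM (ℕₚ.m*n≢0 2 n)}}
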